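{- For every nonnegative integer $n$, $$p\!\left(\frac n2\right)=\sum_{j=0}^{\infty}pod(j)\,q_{e-o}(n-j),$$ where $p(x)=0$ if $x$ is not an integer.
   Context: $p(n)$ denotes the number of (unrestricted) partitions of $n$, with $p(0)=1$. $pod(n)$ denotes the number of partitions of $n$ in which odd parts are distinct and even parts may be repeated, with $pod(0)=1$. $q_{e-o}(n)$ denotes the number of partitions of $n$ into distinct parts with an even number of odd parts minus the number of partitions of $n$ into distinct parts with an odd number of odd parts; $q_{e-o}(0)=1$ and $q_{e-o}(m)=0$ for $m<0$. Its generating function is $\sum_{n\ge0}q_{e-o}(n)q^n=\prod_{k\ge0}\frac{1}{1+q^{2k+1}}$. -}

module Defs where

open import Data.Integer as ℤ using (ℤ; +_; -[1+_]; _⊖_)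
open import Data.List using (List; []; _∷_; length; filter; upTo; cartesianProductWith)
open import Data.List.Membership.Propositional using (_∈_)
open import Data.List.Membership.Propositional.Properties
  using (∈-filter⁺; ∈-filter⁻; ∈-cartesianProductWith⁺; ∈-cartesianProductWith⁻; ∈-upTo⁺)
open import Data.List.Properties using (∷-injective)
open import Data.List.Relation.Unary.All as All using (All; []; _∷_)
open import Data.List.Relation.Unary.Any using (here; there)
open import Data.List.Relation.Unary.Linked using (Linked; linked?)
open import Data.List.Relation.Unary.Unique.DecPropositional using (unique?)
open import Data.List.Relation.Unary.Unique.Propositional using (Unique; []; _∷_)
import Data.List.Relation.Unary.Unique.Propositional.Properties as Unique
open import Data.Nat using (ℕ; zero; suc; _≤_; _<_; _≥_; z≤n; s≤s; _<?_; _≥?_; _≟_)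
open import Data.Nat.Divisibility using (_∣_; _∣?_)
open import Data.Nat.ListAction using (sum)
open import Data.Nat.Properties
  using (≤-trans; +-mono-≤; m≤m+n; m≤n+m)
open import Data.Product using (∃-syntax; _×_; _,_; proj₂)
open import Data.Rational using (ℚ; mkℚ)
open import Function using (_⇔_; mk⇔)
open import Relation.Binary.PropositionalEquality using (_≡_; refl)
open import Relation.Nullary using (¬_; ¬?; _×-dec_)
open import Relation.Unary using (Decidable)

-- A partition is the weakly decreasing list of its parts.
IsPartition : ℕ → List ℕ → Set
IsPartition n xs = Linked _≥_ xs × All (0 <_) xs × sum xs ≡ n

isPartition? : ∀ n → Decidable (IsPartition n)
isPartition? n xs = linked? _≥?_ xs ×-dec All.all? (0 <?_) xs ×-dec sum xs ≟ n

-- Every list of length at most l with entries at most k, once each.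
boundedLists : ℕ → ℕ → List (List ℕ)
boundedLists k zero    = [] ∷ []
boundedLists k (suc l) = [] ∷ cartesianProductWith _∷_ (upTo (suc k)) (boundedLists k l)

-- A partition of n has at most n parts, each at most n, so none is missed
-- (see ∈-partitions and partitions-unique).
partitions : ℕ → List (List ℕ)
partitions n = filter (isPartition? n) (boundedLists n n)

count : {P : List ℕ → Set} → Decidable P → ℕ → ℕ
count P? n = length (filter P? (partitions n))

Odd : ℕ → Set
Odd m = ¬ 2 ∣ m

odd? : Decidable Odd
odd? m = ¬? (2 ∣? m)

oddParts : List ℕ → List ℕ
oddParts = filter odd?

OddPartsDistinct : List ℕ → Set
OddPartsDistinct xs = Unique (oddParts xs)

oddPartsDistinct? : Decidable OddPartsDistinct
oddPartsDistinct? xs = unique? _≟_ (oddParts xs)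

DistinctEven : List ℕ → Set
DistinctEven xs = Unique xs × 2 ∣ length (oddParts xs)

distinctEven? : Decidable DistinctEven
distinctEven? xs = unique? _≟_ xs ×-dec 2 ∣? length (oddParts xs)

DistinctOdd : List ℕ → Set
DistinctOdd xs = Unique xs × Odd (length (oddParts xs))

distinctOdd? : Decidable DistinctOdd
distinctOdd? xs = unique? _≟_ xs ×-dec odd? (length (oddParts xs))

p : ℕ → ℕ
p n = length (partitions n)

-- The extension of p to rational arguments.  A rational in lowest terms is an
-- integer exactly when its denominator is 1, which mkℚ stores as 0.
pℚ : ℚ → ℕ
pℚ (mkℚ (+ n) 0 _) = p n
pℚ _               = 0

pod : ℕ → ℕ
pod = count oddPartsDistinct?

qₑ₋ₒ : ℤ → ℤ
qₑ₋ₒ (+ n)    = count distinctEven? n ⊖ count distinctOdd? n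
qₑ₋ₒ -[1+ _ ] = + 0

partialSum : (ℕ → ℤ) → ℕ → ℤ
partialSum f zero    = + 0
partialSum f (suc N) = partialSum f N ℤ.+ f N

-- f 0 + f 1 + f 2 + … = s.  A sequence of integers converges exactly when it
-- is eventually constant.
_SumsTo_ : (ℕ → ℤ) → ℤ → Set
f SumsTo s = ∃[ M ] (∀ N → M ≤ N → partialSum f N ≡ s)

private
  ∈-boundedLists : ∀ {k} l {xs} → All (_≤ k) xs → length xs ≤ l → xs ∈ boundedLists k l
  ∈-boundedLists zero    []       _         = here refl
  ∈-boundedLists (suc l) []       _         = here refl
  ∈-boundedLists (suc l) (x≤k ∷ b) (s≤s le) =
    there (∈-cartesianProductWith⁺ _∷_ (∈-upTo⁺ (s≤s x≤k)) (∈-boundedLists l b le))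

  boundedLists-unique : ∀ k l → Unique (boundedLists k l)
  boundedLists-unique k zero    = [] ∷ []
  boundedLists-unique k (suc l) =
    All.tabulate []≢ ∷
    Unique.cartesianProductWith⁺ _∷_ ∷-injective
      (Unique.upTo⁺ (suc k)) (boundedLists-unique k l)
    where
    []≢ : ∀ {ys} → ys ∈ cartesianProductWith _∷_ (upTo (suc k)) (boundedLists k l) → ¬ [] ≡ ys
    []≢ ys∈ refl with ∈-cartesianProductWith⁻ _∷_ (upTo (suc k)) (boundedLists k l) ys∈
    ... | _ , _ , _ , _ , ()

  parts≤sum : ∀ xs → All (_≤ sum xs) xs
  parts≤sum []       = []
  parts≤sum (x ∷ xs) =
    m≤m+n x (sum xs) ∷ All.map (λ le → ≤-trans le (m≤n+m (sum xs) x)) (parts≤sum xs)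

  length≤sum : ∀ {xs} → All (0 <_) xs → length xs ≤ sum xs
  length≤sum []        = z≤n
  length≤sum (px ∷ ps) = +-mono-≤ px (length≤sum ps)

∈-partitions : ∀ n xs → xs ∈ partitions n ⇔ IsPartition n xs
∈-partitions n xs = mk⇔
  (λ xs∈ → proj₂ (∈-filter⁻ (isPartition? n) {xs = boundedLists n n} xs∈))
  (λ { h@(_ , pos , refl) →
       ∈-filter⁺ (isPartition? n) (∈-boundedLists n (parts≤sum xs) (length≤sum pos)) h })

partitions-unique : ∀ n → Unique (partitions n)
partitions-unique n = Unique.filter⁺ (isPartition? n) (boundedLists-unique n n)

{-# OPTIONS --safe #-}
module Submission where

-- Let A, D and P be the generating functions of pod, qₑ₋ₒ and p, restricted to
-- parts at most 2m for A and D and to parts at most m for P, and let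
-- T = (1 - q²)(1 - q⁴)⋯(1 - q²ᵐ).  Since (1 + qᵏ)(1 - qᵏ) = 1 - q²ᵏ, both for
-- odd k and for even k, induction on m gives
--   T² A D = (1 - q²)(1 - q⁴)⋯(1 - q⁴ᵐ),
-- while T P(q²) = 1.  Hence T² A D and T² P(q²) = T agree below degree 2m + 2,
-- and T can be cancelled there.  All coefficients up to n are reached by m = n.

open import Defs
open import Data.Bool using (if_then_else_)
open import Data.Empty using (⊥-elim)
open import Data.Nat as ℕ using (ℕ; zero; suc; _≤_; _<_; _≥_; s≤s; z≤n; _≤?_)
import Data.Nat.Properties as ℕ
open import Data.Nat.Divisibility using (_∣_; divides; ∣m+n∣m⇒∣n; ∣m∣n⇒∣m+n; ∣-refl; _∣0; _∣?_)
open import Data.Nat.ListAction using (sum)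
open import Data.Integer using (ℤ; +_; -[1+_]; _+_; _-_; _*_; 0ℤ; 1ℤ; -1ℤ)
import Data.Integer.Properties as ℤ
open import Algebra.Properties.AbelianGroup ℤ.+-0-abelianGroup using (∙-cancelʳ)
open import Data.Integer.Tactic.RingSolver using (solve-∀)
open import Data.List using (List; []; _∷_; _++_; map; filter; length)
open import Data.List.Membership.Propositional using (_∈_; _∉_)
open import Data.List.Membership.Propositional.Properties using (∈-filter⁺; ∈-filter⁻; ∈-++⁺ˡ; ∈-++⁺ʳ; ∈-++⁻; ∈-map⁺; ∈-map⁻)
open import Data.List.Membership.Propositional.Properties.WithK using (unique∧set⇒bag)
open import Data.List.Properties using (filter-all; filter-accept; filter-reject; ∷-injectiveʳ)
open import Data.List.Relation.Binary.BagAndSetEquality using (∼bag⇒↭)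
open import Data.List.Relation.Binary.Permutation.Propositional as ↭ using (_↭_)
open import Data.List.Relation.Unary.All as All using (All; []; _∷_)
import Data.List.Relation.Unary.All.Properties as All
open import Data.List.Relation.Unary.Any using (here; there)
open import Data.List.Relation.Unary.Linked as Linked using (Linked; []; [-]; _∷_)
open import Data.List.Relation.Unary.Linked.Properties using (Linked⇒All)
open import Data.List.Relation.Unary.Unique.Propositional using (Unique; []; _∷_)
import Data.List.Relation.Unary.Unique.Propositional.Properties as Unique
open import Data.Nat.Coprimality using (Coprime; 1-coprimeTo) renaming (sym to coprime-sym)
open import Data.Product using (_×_; _,_; proj₁; proj₂; ∃-syntax)
open import Data.Rational using (mkℚ; _/_)
import Data.Rational.Properties as ℚ
open import Data.Rational.Unnormalised using (mkℚᵘ; *≡*)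
open import Data.Sum using (_⊎_; inj₁; inj₂)
open import Function using (_∘_; const; _⇔_; mk⇔; Equivalence)
open import Relation.Binary.PropositionalEquality using (_≡_; refl; sym; trans; cong; cong₂; subst; _→-setoid_; _≗_; module ≡-Reasoning)
open import Relation.Nullary using (¬_; Dec; yes; no; does; contradiction)
open import Relation.Nullary.Decidable using (does-⇔; dec-false)
open import Relation.Unary using (Decidable)
import Relation.Binary.Reasoning.Setoid as SetoidReasoning

-- Formal power series and multiplication by binomials.

Series : Set
Series = ℕ → ℤ

module ≗-Reasoning = SetoidReasoning (ℕ →-setoid ℤ)

δ : Series
δ zero    = 1ℤ
δ (suc _) = 0ℤ

shift : ℕ → Series → Series
shift zero    f n       = f n
shift (suc k) f zero    = 0ℤ
shift (suc k) f (suc n) = shift k f n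

-- Multiplication by 1 + c q^k.
factor : ℤ → ℕ → Series → Series
factor c k f n = f n + c * shift k f n

shift-cong : ∀ k {f g} → f ≗ g → shift k f ≗ shift k g
shift-cong zero    f≗g n       = f≗g n
shift-cong (suc k) f≗g zero    = refl
shift-cong (suc k) f≗g (suc n) = shift-cong k f≗g n

factor-cong : ∀ c k {f g} → f ≗ g → factor c k f ≗ factor c k g
factor-cong c k f≗g n = cong₂ (λ x y → x + c * y) (f≗g n) (shift-cong k f≗g n)

shift-shift : ∀ j k f → shift j (shift k f) ≗ shift (j ℕ.+ k) f
shift-shift zero    k f n       = refl
shift-shift (suc j) k f zero    = refl
shift-shift (suc j) k f (suc n) = shift-shift j k f n

shift-linear : ∀ k c f g → shift k (λ n → f n + c * g n) ≗ (λ n → shift k f n + c * shift k g n)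
shift-linear zero    c f g n       = refl
shift-linear (suc k) c f g zero    = sym (trans (ℤ.+-identityˡ _) (ℤ.*-zeroʳ c))
shift-linear (suc k) c f g (suc n) = shift-linear k c f g n

shift-+ : ∀ k m f → shift k f (k ℕ.+ m) ≡ f m
shift-+ zero    m f = refl
shift-+ (suc k) m f = shift-+ k m f

shift-< : ∀ {k n} f → n < k → shift k f n ≡ 0ℤ
shift-< {suc k} {zero}  f _         = refl
shift-< {suc k} {suc n} f (s≤s n<k) = shift-< f n<k

factor-factor : ∀ c j d k f n →
  factor c j (factor d k f) n ≡ f n + d * shift k f n + c * (shift j f n + d * shift (j ℕ.+ k) f n)
factor-factor c j d k f n = cong (λ x → factor d k f n + c * x)
  (trans (shift-linear j d f (shift k f) n)
         (cong (λ x → shift j f n + d * x) (shift-shift j k f n)))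

factor-comm : ∀ c j d k f → factor c j (factor d k f) ≗ factor d k (factor c j f)
factor-comm c j d k f n = begin
  factor c j (factor d k f) n
    ≡⟨ factor-factor c j d k f n ⟩
  f n + d * shift k f n + c * (shift j f n + d * shift (j ℕ.+ k) f n)
    ≡⟨ cong (λ i → f n + d * shift k f n + c * (shift j f n + d * shift i f n)) (ℕ.+-comm j k) ⟩
  f n + d * shift k f n + c * (shift j f n + d * shift (k ℕ.+ j) f n)
    ≡⟨ rearrange c d (f n) (shift k f n) (shift j f n) (shift (k ℕ.+ j) f n) ⟩
  f n + c * shift j f n + d * (shift k f n + c * shift (k ℕ.+ j) f n)
    ≡⟨ factor-factor d k c j f n ⟨
  factor d k (factor c j f) n ∎
  where
  open ≡-Reasoning
  rearrange : ∀ c d w x y z → w + d * x + c * (y + d * z) ≡ w + c * y + d * (x + c * z)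
  rearrange = solve-∀

-- The two middle terms `shift k f` have opposite signs and cancel.
factor-conjugates : ∀ k f → factor 1ℤ k (factor -1ℤ k f) ≗ factor -1ℤ (k ℕ.+ k) f
factor-conjugates k f n =
  trans (factor-factor 1ℤ k -1ℤ k f n) (cancel (f n) (shift k f n) (shift (k ℕ.+ k) f n))
  where
  cancel : ∀ x y z → x + -1ℤ * y + 1ℤ * (y + -1ℤ * z) ≡ x + -1ℤ * z
  cancel = solve-∀

-- The hypothesis is the recurrence of a geometric series, `f = g / (1 - q^k)`. Recording it as a
-- product on the left avoids inverting series.
factor-inverse : ∀ k {f g} → (∀ n → f n ≡ g n + shift k f n) → factor -1ℤ k f ≗ g
factor-inverse k {f} {g} f≗ n =
  trans (cong (_+ -1ℤ * shift k f n) (f≗ n)) (cancel (g n) (shift k f n))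
  where
  cancel : ∀ x y → x + y + -1ℤ * y ≡ x
  cancel = solve-∀

-- Congruence modulo `q^N`.
_≈[_]_ : Series → ℕ → Series → Set
f ≈[ N ] g = ∀ n → n < N → f n ≡ g n

-- A shift by a positive amount gains at least one degree of precision, which is what drives the
-- induction in `factor-cancel`.
shift-local : ∀ k N {f g} → f ≈[ N ] g → shift (suc k) f ≈[ suc N ] shift (suc k) g
shift-local k       N f≈g zero    _         = refl
shift-local zero    N f≈g (suc n) (s≤s n<N) = f≈g n n<N
shift-local (suc k) N f≈g (suc n) (s≤s n<N) = shift-local k N f≈g n (ℕ.m≤n⇒m≤1+n n<N)

-- The binomial has constant term 1 because its exponent is positive. So coefficient `n` of the
-- product determines coefficient `n` of `f` once all lower coefficients are known.
factor-cancel : ∀ c k N {f g} → factor c (suc k) f ≈[ N ] factor c (suc k) g → f ≈[ N ] g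
factor-cancel c k zero    eq n ()
factor-cancel c k (suc N) {f} {g} eq n n<1+N =
  ∙-cancelʳ (c * shift (suc k) g n) (f n) (g n)
    (trans (cong (λ x → f n + c * x) (sym (shift-local k N f≈g n n<1+N))) (eq n n<1+N))
  where
  f≈g : f ≈[ N ] g
  f≈g = factor-cancel c k N (λ i i<N → eq i (ℕ.m≤n⇒m≤1+n i<N))

factor-< : ∀ c {k n} f → n < k → factor c k f n ≡ f n
factor-< c f n<k =
  trans (cong (λ x → f _ + c * x) (shift-< f n<k)) (trans (cong (λ x → f _ + x) (ℤ.*-zeroʳ c)) (ℤ.+-identityʳ _))

-- Multiplication by (1 - q²)(1 - q⁴)⋯(1 - q²ᵐ).
evenFactors : ℕ → Series → Series
evenFactors zero    f = f
evenFactors (suc m) f = factor -1ℤ (suc m ℕ.+ suc m) (evenFactors m f)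

evenFactors-cong : ∀ m {f g} → f ≗ g → evenFactors m f ≗ evenFactors m g
evenFactors-cong zero    f≗g = f≗g
evenFactors-cong (suc m) f≗g = factor-cong -1ℤ (suc m ℕ.+ suc m) (evenFactors-cong m f≗g)

evenFactors-factor : ∀ m c k f → evenFactors m (factor c k f) ≗ factor c k (evenFactors m f)
evenFactors-factor zero    c k f n = refl
evenFactors-factor (suc m) c k f = begin
  factor -1ℤ (suc m ℕ.+ suc m) (evenFactors m (factor c k f))
    ≈⟨ factor-cong -1ℤ (suc m ℕ.+ suc m) (evenFactors-factor m c k f) ⟩
  factor -1ℤ (suc m ℕ.+ suc m) (factor c k (evenFactors m f))
    ≈⟨ factor-comm -1ℤ (suc m ℕ.+ suc m) c k (evenFactors m f) ⟩
  factor c k (evenFactors (suc m) f) ∎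
  where open ≗-Reasoning

evenFactors-cancel : ∀ m N {f g} → evenFactors m f ≈[ N ] evenFactors m g → f ≈[ N ] g
evenFactors-cancel zero    N eq = eq
evenFactors-cancel (suc m) N eq = evenFactors-cancel m N (factor-cancel -1ℤ (m ℕ.+ suc m) N eq)

-- Each additional factor is `1 - q^(2i)` with `i > m`, which changes nothing below degree `2m + 2`.
-- The cruder bound `m + 1` suffices, since only coefficient `m` is read in the end.
evenFactors-stable : ∀ d m f → evenFactors (d ℕ.+ m) f ≈[ suc m ] evenFactors m f
evenFactors-stable zero    m f n n≤m = refl
evenFactors-stable (suc d) m f n n≤m =
  trans (factor-< -1ℤ (evenFactors (d ℕ.+ m) f)
          (ℕ.≤-trans n≤m (ℕ.≤-trans (s≤s (ℕ.m≤n+m m d)) (ℕ.m≤m+n (suc d ℕ.+ m) (suc d ℕ.+ m)))))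
        (evenFactors-stable d m f n n≤m)

-- The Cauchy product.

infixl 7 _⊛_

-- The recursion splits off the constant term of the left factor, `f = f 0 + q (f ∘ suc)`. This is
-- also how a finite sum is unrolled from the front in `partialSum-⊛`.
_⊛_ : Series → Series → Series
(f ⊛ g) zero    = f 0 * g 0
(f ⊛ g) (suc n) = f 0 * g (suc n) + ((f ∘ suc) ⊛ g) n

-- Used to replace the full generating functions by those with bounded parts, which agree with them
-- only in low degrees.
⊛-local : ∀ {f f′ g g′} n → f ≈[ suc n ] f′ → g ≈[ suc n ] g′ → (f ⊛ g) n ≡ (f′ ⊛ g′) n
⊛-local zero    f≈ g≈ = cong₂ _*_ (f≈ 0 (s≤s z≤n)) (g≈ 0 (s≤s z≤n))
⊛-local (suc n) f≈ g≈ = cong₂ _+_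
  (cong₂ _*_ (f≈ 0 (s≤s z≤n)) (g≈ (suc n) ℕ.≤-refl))
  (⊛-local n (λ i i≤n → f≈ (suc i) (s≤s i≤n)) (λ i i≤n → g≈ i (ℕ.m≤n⇒m≤1+n i≤n)))

⊛-cong : ∀ {f f′ g g′} → f ≗ f′ → g ≗ g′ → f ⊛ g ≗ f′ ⊛ g′
⊛-cong f≗ g≗ n = ⊛-local n (λ i _ → f≗ i) (λ i _ → g≗ i)

⊛-linearˡ : ∀ c f f′ g → (λ n → f n + c * f′ n) ⊛ g ≗ (λ n → (f ⊛ g) n + c * (f′ ⊛ g) n)
⊛-linearˡ c f f′ g zero    = distrib c (f 0) (f′ 0) (g 0)
  where
  distrib : ∀ c x y z → (x + c * y) * z ≡ x * z + c * (y * z)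
  distrib = solve-∀
⊛-linearˡ c f f′ g (suc n) =
  trans (cong (λ x → (f 0 + c * f′ 0) * g (suc n) + x) (⊛-linearˡ c (f ∘ suc) (f′ ∘ suc) g n))
        (distrib c (f 0) (f′ 0) (g (suc n)) (((f ∘ suc) ⊛ g) n) (((f′ ∘ suc) ⊛ g) n))
  where
  distrib : ∀ c x y z u v → (x + c * y) * z + (u + c * v) ≡ x * z + u + c * (y * z + v)
  distrib = solve-∀

⊛-linearʳ : ∀ c f g g′ → f ⊛ (λ n → g n + c * g′ n) ≗ (λ n → (f ⊛ g) n + c * (f ⊛ g′) n)
⊛-linearʳ c f g g′ zero    = distrib c (f 0) (g 0) (g′ 0)
  where
  distrib : ∀ c x y z → x * (y + c * z) ≡ x * y + c * (x * z)
  distrib = solve-∀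
⊛-linearʳ c f g g′ (suc n) =
  trans (cong (λ x → f 0 * (g (suc n) + c * g′ (suc n)) + x) (⊛-linearʳ c (f ∘ suc) g g′ n))
        (distrib c (f 0) (g (suc n)) (g′ (suc n)) (((f ∘ suc) ⊛ g) n) (((f ∘ suc) ⊛ g′) n))
  where
  distrib : ∀ c x y z u v → x * (y + c * z) + (u + c * v) ≡ x * y + u + c * (x * z + v)
  distrib = solve-∀

-- The recursion of `⊛` moves one degree at a time, so shifts inside a product are reduced to
-- iterated shifts by one.
shift-suc : ∀ k f → shift (suc k) f ≗ shift 1 (shift k f)
shift-suc k f zero    = refl
shift-suc k f (suc n) = refl

⊛-shift₁ˡ : ∀ f g → shift 1 f ⊛ g ≗ shift 1 (f ⊛ g)
⊛-shift₁ˡ f g zero    = refl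
⊛-shift₁ˡ f g (suc n) = ℤ.+-identityˡ _

⊛-shift₁ʳ : ∀ f g → f ⊛ shift 1 g ≗ shift 1 (f ⊛ g)
⊛-shift₁ʳ f g zero          = ℤ.*-zeroʳ (f 0)
⊛-shift₁ʳ f g (suc zero)    = trans (cong (λ x → f 0 * g 0 + x) (ℤ.*-zeroʳ (f 1))) (ℤ.+-identityʳ _)
⊛-shift₁ʳ f g (suc (suc n)) = cong (λ x → f 0 * g (suc n) + x) (⊛-shift₁ʳ (f ∘ suc) g (suc n))

⊛-shiftˡ : ∀ k f g → shift k f ⊛ g ≗ shift k (f ⊛ g)
⊛-shiftˡ zero    f g n = refl
⊛-shiftˡ (suc k) f g = begin
  shift (suc k) f ⊛ g     ≈⟨ ⊛-cong (shift-suc k f) (λ _ → refl) ⟩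
  shift 1 (shift k f) ⊛ g ≈⟨ ⊛-shift₁ˡ (shift k f) g ⟩
  shift 1 (shift k f ⊛ g) ≈⟨ shift-cong 1 (⊛-shiftˡ k f g) ⟩
  shift 1 (shift k (f ⊛ g)) ≈⟨ shift-suc k (f ⊛ g) ⟨
  shift (suc k) (f ⊛ g)   ∎
  where open ≗-Reasoning

⊛-shiftʳ : ∀ k f g → f ⊛ shift k g ≗ shift k (f ⊛ g)
⊛-shiftʳ zero    f g n = refl
⊛-shiftʳ (suc k) f g = begin
  f ⊛ shift (suc k) g     ≈⟨ ⊛-cong {f} (λ _ → refl) (shift-suc k g) ⟩
  f ⊛ shift 1 (shift k g) ≈⟨ ⊛-shift₁ʳ f (shift k g) ⟩
  shift 1 (f ⊛ shift k g) ≈⟨ shift-cong 1 (⊛-shiftʳ k f g) ⟩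
  shift 1 (shift k (f ⊛ g)) ≈⟨ shift-suc k (f ⊛ g) ⟨
  shift (suc k) (f ⊛ g)   ∎
  where open ≗-Reasoning

-- Together with `⊛-factorʳ` this does the work of associativity and commutativity: the product is
-- only ever rearranged by pulling binomials out of either side.
⊛-factorˡ : ∀ c k f g → factor c k f ⊛ g ≗ factor c k (f ⊛ g)
⊛-factorˡ c k f g n =
  trans (⊛-linearˡ c f (shift k f) g n) (cong (λ x → (f ⊛ g) n + c * x) (⊛-shiftˡ k f g n))

⊛-factorʳ : ∀ c k f g → f ⊛ factor c k g ≗ factor c k (f ⊛ g)
⊛-factorʳ c k f g n =
  trans (⊛-linearʳ c f g (shift k g) n) (cong (λ x → (f ⊛ g) n + c * x) (⊛-shiftʳ k f g n))

-- The substitution q ↦ q².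
spread : Series → Series
spread f zero          = f zero
spread f (suc zero)    = 0ℤ
spread f (suc (suc n)) = spread (f ∘ suc) n

spread-local : ∀ {f g} n → f ≈[ suc n ] g → spread f n ≡ spread g n
spread-local zero          f≈g = f≈g 0 (s≤s z≤n)
spread-local (suc zero)    f≈g = refl
spread-local (suc (suc n)) f≈g = spread-local n (λ i i≤n → f≈g (suc i) (s≤s (ℕ.m≤n⇒m≤1+n i≤n)))

spread-cong : ∀ {f g} → f ≗ g → spread f ≗ spread g
spread-cong f≗g n = spread-local n (λ i _ → f≗g i)

spread-linear : ∀ c f g → spread (λ n → f n + c * g n) ≗ (λ n → spread f n + c * spread g n)
spread-linear c f g zero          = refl
spread-linear c f g (suc zero)    = sym (trans (ℤ.+-identityˡ _) (ℤ.*-zeroʳ c))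
spread-linear c f g (suc (suc n)) = spread-linear c (f ∘ suc) (g ∘ suc) n

spread-0 : ∀ n → spread (λ _ → 0ℤ) n ≡ 0ℤ
spread-0 zero          = refl
spread-0 (suc zero)    = refl
spread-0 (suc (suc n)) = spread-0 n

spread-δ : spread δ ≗ δ
spread-δ zero          = refl
spread-δ (suc zero)    = refl
spread-δ (suc (suc n)) = spread-0 n

spread-shift : ∀ k f → spread (shift k f) ≗ shift (k ℕ.+ k) (spread f)
spread-shift zero    f n = refl
-- The rewrite exposes two successors in the exponent, matching the step of two in `spread`.
spread-shift (suc k) f n rewrite ℕ.+-suc k k = go n
  where
  go : spread (shift (suc k) f) ≗ shift (suc (suc (k ℕ.+ k))) (spread f)
  go zero          = refl
  go (suc zero)    = refl
  go (suc (suc n)) = spread-shift k f n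

spread-factor : ∀ c k f → spread (factor c k f) ≗ factor c (k ℕ.+ k) (spread f)
spread-factor c k f n =
  trans (spread-linear c f (shift k f) n) (cong (λ x → spread f n + c * x) (spread-shift k f n))

spread-double : ∀ f m → spread f (m ℕ.+ m) ≡ f m
spread-double f zero    = refl
spread-double f (suc m) rewrite ℕ.+-suc m m = spread-double (f ∘ suc) m

spread-double+1 : ∀ f m → spread f (suc (m ℕ.+ m)) ≡ 0ℤ
spread-double+1 f zero    = refl
spread-double+1 f (suc m) rewrite ℕ.+-suc m m = spread-double+1 (f ∘ suc) m

-- The product identity, derived from recurrences in the bound on parts.

-- A k, D k and P k are to be the generating functions of pod, qₑ₋ₒ and p
-- restricted to partitions with all parts at most k.
module _ (A D P : ℕ → Series)
  (A-zero : A 0 ≗ δ) (D-zero : D 0 ≗ δ) (P-zero : P 0 ≗ δ)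
  -- A part that occurs at most once contributes `1 + q^k`, or `1 - q^k` when it also flips the
  -- sign. A repeatable part contributes `1 / (1 - q^k)`, stated by multiplying the left side
  -- instead.
  (A-odd  : ∀ m → A (suc (m ℕ.+ m)) ≗ factor 1ℤ (suc (m ℕ.+ m)) (A (m ℕ.+ m)))
  (A-even : ∀ m → factor -1ℤ (suc m ℕ.+ suc m) (A (suc m ℕ.+ suc m)) ≗ A (suc (m ℕ.+ m)))
  (D-odd  : ∀ m → D (suc (m ℕ.+ m)) ≗ factor -1ℤ (suc (m ℕ.+ m)) (D (m ℕ.+ m)))
  (D-even : ∀ m → D (suc m ℕ.+ suc m) ≗ factor 1ℤ (suc m ℕ.+ suc m) (D (suc (m ℕ.+ m))))
  (P-suc  : ∀ m → factor -1ℤ (suc m) (P (suc m)) ≗ P m)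
  where

  B : ℕ → Series
  B m = A (m ℕ.+ m) ⊛ D (m ℕ.+ m)

  δ-⊛-δ : δ ⊛ δ ≗ δ
  δ-⊛-δ zero    = refl
  δ-⊛-δ (suc n) = trans (ℤ.+-identityˡ _) (zero-⊛ δ n)
    where
    zero-⊛ : ∀ g n → ((λ _ → 0ℤ) ⊛ g) n ≡ 0ℤ
    zero-⊛ g zero    = refl
    zero-⊛ g (suc n) = trans (ℤ.+-identityˡ _) (zero-⊛ g n)

  -- Raising the bound by two admits one odd part `k` and one even part `l`. `A` gains
  -- `(1 + q^k) / (1 - q^l)` and `D` gains `(1 - q^k)(1 + q^l)`; the two factors in `q^k` combine as
  -- conjugates.
  B-suc : ∀ m → let k = suc (m ℕ.+ m); l = suc m ℕ.+ suc m in
    factor -1ℤ l (B (suc m)) ≗ factor 1ℤ l (factor -1ℤ (k ℕ.+ k) (B m))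
  B-suc m = begin
    factor -1ℤ l (A l ⊛ D l)                           ≈⟨ ⊛-factorˡ -1ℤ l (A l) (D l) ⟨
    factor -1ℤ l (A l) ⊛ D l                           ≈⟨ ⊛-cong (A-even m) (D-even m) ⟩
    A k ⊛ factor 1ℤ l (D k)                            ≈⟨ ⊛-factorʳ 1ℤ l (A k) (D k) ⟩
    factor 1ℤ l (A k ⊛ D k)                            ≈⟨ factor-cong 1ℤ l (begin
      A k ⊛ D k                                          ≈⟨ ⊛-cong (A-odd m) (D-odd m) ⟩
      factor 1ℤ k A′ ⊛ factor -1ℤ k D′                   ≈⟨ ⊛-factorˡ 1ℤ k A′ (factor -1ℤ k D′) ⟩
      factor 1ℤ k (A′ ⊛ factor -1ℤ k D′)                 ≈⟨ factor-cong 1ℤ k (⊛-factorʳ -1ℤ k A′ D′) ⟩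
      factor 1ℤ k (factor -1ℤ k (A′ ⊛ D′))               ≈⟨ factor-conjugates k (A′ ⊛ D′) ⟩
      factor -1ℤ (k ℕ.+ k) (A′ ⊛ D′)                     ∎) ⟩
    factor 1ℤ l (factor -1ℤ (k ℕ.+ k) (A′ ⊛ D′))       ∎
    where
    open ≗-Reasoning
    k = suc (m ℕ.+ m)
    l = suc m ℕ.+ suc m
    A′ = A (m ℕ.+ m)
    D′ = D (m ℕ.+ m)

  -- Each of the two outer products gains a factor `1 - q^l`. One clears the denominator of `B-suc`;
  -- the other meets `1 + q^l` and becomes `1 - q^(2l)`.
  evenFactors²-B : ∀ m → evenFactors m (evenFactors m (B m)) ≗ evenFactors (m ℕ.+ m) δ
  evenFactors²-B zero    n = trans (⊛-cong A-zero D-zero n) (δ-⊛-δ n)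
  evenFactors²-B (suc m) = begin
    factor -1ℤ l (T (factor -1ℤ l (T (B (suc m)))))
      ≈⟨ factor-cong -1ℤ l (evenFactors-cong m (evenFactors-factor m -1ℤ l (B (suc m)))) ⟨
    factor -1ℤ l (T (T (factor -1ℤ l (B (suc m)))))
      ≈⟨ factor-cong -1ℤ l (evenFactors-cong m (evenFactors-cong m (B-suc m))) ⟩
    factor -1ℤ l (T (T (factor 1ℤ l (factor -1ℤ (k ℕ.+ k) (B m)))))
      ≈⟨ factor-cong -1ℤ l (pullOut 1ℤ l (factor -1ℤ (k ℕ.+ k) (B m))) ⟩
    factor -1ℤ l (factor 1ℤ l (T (T (factor -1ℤ (k ℕ.+ k) (B m)))))
      ≈⟨ factor-comm -1ℤ l 1ℤ l (T (T (factor -1ℤ (k ℕ.+ k) (B m)))) ⟩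
    factor 1ℤ l (factor -1ℤ l (T (T (factor -1ℤ (k ℕ.+ k) (B m)))))
      ≈⟨ factor-conjugates l (T (T (factor -1ℤ (k ℕ.+ k) (B m)))) ⟩
    factor -1ℤ (l ℕ.+ l) (T (T (factor -1ℤ (k ℕ.+ k) (B m))))
      ≈⟨ factor-cong -1ℤ (l ℕ.+ l) (pullOut -1ℤ (k ℕ.+ k) (B m)) ⟩
    factor -1ℤ (l ℕ.+ l) (factor -1ℤ (k ℕ.+ k) (T (T (B m))))
      ≈⟨ factor-cong -1ℤ (l ℕ.+ l) (factor-cong -1ℤ (k ℕ.+ k) (evenFactors²-B m)) ⟩
    -- `k` and `l` are the two indices following `m + m`, so both new factors are absorbed by
    -- unfolding `evenFactors`.
    factor -1ℤ (l ℕ.+ l) (evenFactors k δ)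
      ≡⟨ cong (λ i → factor -1ℤ (l ℕ.+ l) (evenFactors i δ)) (ℕ.+-suc m m) ⟨
    evenFactors l δ ∎
    where
    open ≗-Reasoning
    k = suc (m ℕ.+ m)
    l = suc m ℕ.+ suc m
    T = evenFactors m

    pullOut : ∀ c j f → T (T (factor c j f)) ≗ factor c j (T (T f))
    pullOut c j f = begin
      T (T (factor c j f)) ≈⟨ evenFactors-cong m (evenFactors-factor m c j f) ⟩
      T (factor c j (T f)) ≈⟨ evenFactors-factor m c j (T f) ⟩
      factor c j (T (T f)) ∎

  -- Under `q ↦ q²` the denominator `1 - q^(m+1)` gained by `P` becomes exactly the new factor of
  -- `evenFactors`.
  evenFactors-spread-P : ∀ m → evenFactors m (spread (P m)) ≗ δ
  evenFactors-spread-P zero    n = trans (spread-cong P-zero n) (spread-δ n)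
  evenFactors-spread-P (suc m) = begin
    factor -1ℤ l (evenFactors m (spread (P (suc m))))
      ≈⟨ evenFactors-factor m -1ℤ l (spread (P (suc m))) ⟨
    evenFactors m (factor -1ℤ l (spread (P (suc m))))
      ≈⟨ evenFactors-cong m (spread-factor -1ℤ (suc m) (P (suc m))) ⟨
    evenFactors m (spread (factor -1ℤ (suc m) (P (suc m))))
      ≈⟨ evenFactors-cong m (spread-cong (P-suc m)) ⟩
    evenFactors m (spread (P m)) ≈⟨ evenFactors-spread-P m ⟩
    δ ∎
    where
    open ≗-Reasoning
    l = suc m ℕ.+ suc m

  ⊛-≈-spread : ∀ m → (A (m ℕ.+ m) ⊛ D (m ℕ.+ m)) ≈[ suc m ] spread (P m)
  ⊛-≈-spread m = evenFactors-cancel m (suc m) (evenFactors-cancel m (suc m) λ n n≤m → begin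
    evenFactors m (evenFactors m (B m)) n          ≡⟨ evenFactors²-B m n ⟩
    evenFactors (m ℕ.+ m) δ n                      ≡⟨ evenFactors-stable m m δ n n≤m ⟩
    evenFactors m δ n                              ≡⟨ evenFactors-cong m (evenFactors-spread-P m) n ⟨
    evenFactors m (evenFactors m (spread (P m))) n ∎)
    where open ≡-Reasoning

-- Partitions with bounded parts.

parts : ℕ → ℕ → List (List ℕ)
parts k n = filter (All.all? (_≤? k)) (partitions n)

∈-parts⁻ : ∀ k n {xs} → xs ∈ parts k n → IsPartition n xs × All (_≤ k) xs
∈-parts⁻ k n {xs} xs∈ =
  let xs∈ps , xs≤k = ∈-filter⁻ (All.all? (_≤? k)) {xs = partitions n} xs∈
  in Equivalence.to (∈-partitions n xs) xs∈ps , xs≤k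

∈-parts⁺ : ∀ k n {xs} → IsPartition n xs → All (_≤ k) xs → xs ∈ parts k n
∈-parts⁺ k n {xs} isP xs≤k =
  ∈-filter⁺ (All.all? (_≤? k)) (Equivalence.from (∈-partitions n xs) isP) xs≤k

parts-unique : ∀ k n → Unique (parts k n)
parts-unique k n = Unique.filter⁺ (All.all? (_≤? k)) (partitions-unique n)

parts-≥ : ∀ {k n} → n ≤ k → parts k n ≡ partitions n
parts-≥ {k} {n} n≤k = filter-all (All.all? (_≤? k)) (All.tabulate bounded)
  where
  All-≤-sum : ∀ xs → All (_≤ sum xs) xs
  All-≤-sum []       = []
  All-≤-sum (x ∷ xs) = ℕ.m≤m+n x (sum xs) ∷ All.map (λ le → ℕ.≤-trans le (ℕ.m≤n+m (sum xs) x)) (All-≤-sum xs)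

  bounded : ∀ {xs} → xs ∈ partitions n → All (_≤ k) xs
  bounded {xs} xs∈ with _ , _ , refl ← Equivalence.to (∈-partitions n xs) xs∈ =
    All.map (λ le → ℕ.≤-trans le n≤k) (All-≤-sum xs)

parts-0 : ∀ n → parts 0 (suc n) ≡ []
parts-0 n = empty (λ {xs} → no-parts {xs} ∘ ∈-parts⁻ 0 (suc n))
  where
  empty : {xss : List (List ℕ)} → (∀ {xs} → xs ∉ xss) → xss ≡ []
  empty {[]}     _   = refl
  empty {_ ∷ _} none = ⊥-elim (none (here refl))

  no-parts : ∀ {xs} → ¬ (IsPartition (suc n) xs × All (_≤ 0) xs)
  no-parts {[]}    ((_ , _ , ()) , _)
  no-parts {_ ∷ _} ((_ , 0<x ∷ _ , _) , x≤0 ∷ _) = ℕ.<⇒≱ 0<x x≤0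

-- Either no part equals `k + 1`, or deleting one copy of it leaves a partition of `m` whose parts
-- may still equal `k + 1`. Both lists are free of duplicates, so having the same members makes them
-- permutations of each other.
parts-suc : ∀ k m →
  parts (suc k) (suc k ℕ.+ m) ↭ parts k (suc k ℕ.+ m) ++ map (suc k ∷_) (parts (suc k) m)
parts-suc k m = ∼bag⇒↭ (unique∧set⇒bag (parts-unique (suc k) n)
  (Unique.++⁺ (parts-unique k n) (Unique.map⁺ ∷-injectiveʳ (parts-unique (suc k) m)) disjoint)
  (mk⇔ to from))
  where
  n = suc k ℕ.+ m
  small = parts k n
  large = map (suc k ∷_) (parts (suc k) m)

  disjoint : ∀ {xs} → ¬ (xs ∈ small × xs ∈ large)
  disjoint (xs∈small , xs∈large) with _ , _ , refl ← ∈-map⁻ (suc k ∷_) xs∈large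
    with _ , (1+k≤k ∷ _) ← ∈-parts⁻ k n xs∈small = ℕ.1+n≰n 1+k≤k

  to : ∀ {xs} → xs ∈ parts (suc k) n → xs ∈ small ++ large
  to {xs} xs∈ with ∈-parts⁻ (suc k) n xs∈
  to {[]}     _ | isP , [] = ∈-++⁺ˡ (∈-parts⁺ k n isP [])
  to {x ∷ ys} _ | isP@(linked , _ ∷ pos , sum≡) , x≤1+k ∷ ys≤1+k with x ℕ.≟ suc k
  ... | yes refl  = ∈-++⁺ʳ small (∈-map⁺ (suc k ∷_)
          (∈-parts⁺ (suc k) m (Linked.tail linked , pos , ℕ.+-cancelˡ-≡ (suc k) (sum ys) m sum≡) ys≤1+k))
  -- The list is weakly decreasing, so a head of at most `k` bounds all its entries.
  ... | no x≢1+k = ∈-++⁺ˡ (∈-parts⁺ k n isP (Linked⇒All (λ a≥b b≥c → ℕ.≤-trans b≥c a≥b)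
          (ℕ.≤-pred (ℕ.≤∧≢⇒< x≤1+k x≢1+k)) linked))

  cons-linked : ∀ {ys} → All (_≤ suc k) ys → Linked _≥_ ys → Linked _≥_ (suc k ∷ ys)
  cons-linked []        _      = [-]
  cons-linked (y≤ ∷ _) linked = y≤ ∷ linked

  from : ∀ {xs} → xs ∈ small ++ large → xs ∈ parts (suc k) n
  from xs∈ with ∈-++⁻ small xs∈
  ... | inj₁ xs∈small =
    let isP , xs≤k = ∈-parts⁻ k n xs∈small in ∈-parts⁺ (suc k) n isP (All.map ℕ.m≤n⇒m≤1+n xs≤k)
  ... | inj₂ xs∈large with ys , ys∈ , refl ← ∈-map⁻ (suc k ∷_) xs∈large
    with (linked , pos , sum≡) , ys≤ ← ∈-parts⁻ (suc k) m ys∈ =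
    ∈-parts⁺ (suc k) n (cons-linked ys≤ linked , s≤s z≤n ∷ pos , cong (suc k ℕ.+_) sum≡) (ℕ.≤-refl ∷ ys≤)

-- Weighted generating functions of partitions.

total : (List ℕ → ℤ) → List (List ℕ) → ℤ
total w []         = 0ℤ
total w (xs ∷ xss) = w xs + total w xss

total-++ : ∀ w xss yss → total w (xss ++ yss) ≡ total w xss + total w yss
total-++ w []         yss = sym (ℤ.+-identityˡ _)
total-++ w (xs ∷ xss) yss =
  trans (cong (λ x → w xs + x) (total-++ w xss yss)) (sym (ℤ.+-assoc (w xs) (total w xss) (total w yss)))

total-map : ∀ w (f : List ℕ → List ℕ) xss → total w (map f xss) ≡ total (w ∘ f) xss
total-map w f []         = refl
total-map w f (xs ∷ xss) = cong (λ x → w (f xs) + x) (total-map w f xss)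

total-↭ : ∀ w {xss yss} → xss ↭ yss → total w xss ≡ total w yss
total-↭ w ↭.refl            = refl
total-↭ w (↭.prep xs p)   = cong (λ x → w xs + x) (total-↭ w p)
total-↭ w (↭.swap xs ys p)  = trans (cong (λ x → w xs + (w ys + x)) (total-↭ w p)) (exchange (w xs) (w ys) _)
  where
  exchange : ∀ a b c → a + (b + c) ≡ b + (a + c)
  exchange = solve-∀
total-↭ w (↭.trans p q)   = trans (total-↭ w p) (total-↭ w q)

total-cong : ∀ {w v} xss → (∀ {xs} → xs ∈ xss → w xs ≡ v xs) → total w xss ≡ total v xss
total-cong []         eq = refl
total-cong (xs ∷ xss) eq = cong₂ _+_ (eq (here refl)) (total-cong xss (eq ∘ there))

total-linear : ∀ c w v xss → total (λ xs → w xs + c * v xs) xss ≡ total w xss + c * total v xss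
total-linear c w v []         = sym (trans (ℤ.+-identityˡ _) (ℤ.*-zeroʳ c))
total-linear c w v (xs ∷ xss) =
  trans (cong (λ x → w xs + c * v xs + x) (total-linear c w v xss))
          (regroup c (w xs) (v xs) (total w xss) (total v xss))
  where
  regroup : ∀ c x y s t → x + c * y + (s + c * t) ≡ x + s + c * (y + t)
  regroup = solve-∀

total-0 : ∀ xss → total (const 0ℤ) xss ≡ 0ℤ
total-0 []         = refl
total-0 (xs ∷ xss) = trans (ℤ.+-identityˡ _) (total-0 xss)

total-scale : ∀ c w xss → total (λ xs → c * w xs) xss ≡ c * total w xss
total-scale c w []         = sym (ℤ.*-zeroʳ c)
total-scale c w (xs ∷ xss) =
  trans (cong (λ x → c * w xs + x) (total-scale c w xss)) (sym (ℤ.*-distribˡ-+ c (w xs) (total w xss)))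

-- A single definition covers all three series: `podWeight` gives `A`, `signWeight` gives `D`, and
-- the constant weight 1 gives `P`.
gf : (List ℕ → ℤ) → ℕ → Series
gf w k n = total w (parts k n)

gf-≥ : ∀ w {k n} → n ≤ k → gf w k n ≡ total w (partitions n)
gf-≥ w n≤k = cong (total w) (parts-≥ n≤k)

gf-zero : ∀ w → w [] ≡ 1ℤ → gf w 0 ≗ δ
gf-zero w w[]≡1 zero    = trans (ℤ.+-identityʳ (w [])) w[]≡1
gf-zero w w[]≡1 (suc n) = cong (total w) (parts-0 n)

-- This is `parts-suc` summed. The deleted part is remembered in the weight, which is therefore
-- arbitrary.
gf-suc : ∀ w k n → gf w (suc k) n ≡ gf w k n + shift (suc k) (gf (w ∘ (suc k ∷_)) (suc k)) n
gf-suc w k n with suc k ≤? n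
-- For `n ≤ k` both bounds on the parts are vacuous and the shifted term is 0.
... | no k≮n = begin
  gf w (suc k) n      ≡⟨ gf-≥ w (ℕ.m≤n⇒m≤1+n n≤k) ⟩
  total w (partitions n) ≡⟨ gf-≥ w n≤k ⟨
  gf w k n            ≡⟨ ℤ.+-identityʳ (gf w k n) ⟨
  gf w k n + 0ℤ       ≡⟨ cong (λ x → gf w k n + x) (shift-< _ (s≤s n≤k)) ⟨
  gf w k n + shift (suc k) (gf (w ∘ (suc k ∷_)) (suc k)) n ∎
  where
  open ≡-Reasoning
  n≤k = ℕ.≮⇒≥ k≮n
... | yes k<n with m , refl ← ℕ.m≤n⇒∃[o]m+o≡n k<n = begin
  total w (parts (suc k) n)                                        ≡⟨ total-↭ w (parts-suc k m) ⟩
  total w (parts k n ++ map (suc k ∷_) (parts (suc k) m))          ≡⟨ total-++ w (parts k n) _ ⟩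
  gf w k n + total w (map (suc k ∷_) (parts (suc k) m))
    ≡⟨ cong (λ x → gf w k n + x) (total-map w (suc k ∷_) (parts (suc k) m)) ⟩
  gf w k n + gf (w ∘ (suc k ∷_)) (suc k) m
    ≡⟨ cong (λ x → gf w k n + x) (shift-+ (suc k) m _) ⟨
  gf w k n + shift (suc k) (gf (w ∘ (suc k ∷_)) (suc k)) n         ∎
  where open ≡-Reasoning

-- As the weight ignores the part `k + 1`, `gf-suc` turns into the geometric recurrence of
-- `factor-inverse`.
gf-repeatable : ∀ w k → (∀ ys → w (suc k ∷ ys) ≡ w ys) → factor -1ℤ (suc k) (gf w (suc k)) ≗ gf w k
gf-repeatable w k eq = factor-inverse (suc k) λ n →
  trans (gf-suc w k n)
    (cong (λ x → gf w k n + x) (shift-cong (suc k) (λ m → total-cong (parts (suc k) m) (λ {ys} _ → eq ys)) n))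

-- `gf-suc` is applied twice: the first copy of `k + 1` scales the weight by `c`, and a second copy
-- kills it.
gf-distinct : ∀ w k c → (∀ ys → w (suc k ∷ suc k ∷ ys) ≡ 0ℤ) →
  (∀ ys → All (_≤ k) ys → w (suc k ∷ ys) ≡ c * w ys) → gf w (suc k) ≗ factor c (suc k) (gf w k)
gf-distinct w k c repeated fresh n = begin
  gf w (suc k) n                             ≡⟨ gf-suc w k n ⟩
  gf w k n + shift (suc k) (gf v (suc k)) n  ≡⟨ cong (λ x → gf w k n + x) (shift-cong (suc k) gf-v n) ⟩
  gf w k n + shift (suc k) (λ m → c * gf w k m) n
    ≡⟨ cong (λ x → gf w k n + x) (shift-scale (suc k) c (gf w k) n) ⟩
  factor c (suc k) (gf w k) n ∎
  where
  open ≡-Reasoning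
  v = w ∘ (suc k ∷_)

  shift-0 : ∀ k → shift k (const 0ℤ) ≗ const 0ℤ
  shift-0 zero    n       = refl
  shift-0 (suc k) zero    = refl
  shift-0 (suc k) (suc n) = shift-0 k n

  shift-scale : ∀ k c f → shift k (λ n → c * f n) ≗ (λ n → c * shift k f n)
  shift-scale zero    c f n       = refl
  shift-scale (suc k) c f zero    = sym (ℤ.*-zeroʳ c)
  shift-scale (suc k) c f (suc n) = shift-scale k c f n

  gf-v : ∀ m → gf v (suc k) m ≡ c * gf w k m
  gf-v m = begin
    gf v (suc k) m                                             ≡⟨ gf-suc v k m ⟩
    gf v k m + shift (suc k) (gf (v ∘ (suc k ∷_)) (suc k)) m   ≡⟨ cong₂ _+_
      (total-cong (parts k m) (λ {ys} ys∈ → fresh ys (proj₂ (∈-parts⁻ k m ys∈))))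
      (shift-cong (suc k) (λ i → total-cong (parts (suc k) i) (λ {ys} _ → repeated ys)) m) ⟩
    total (λ ys → c * w ys) (parts k m) + shift (suc k) (gf (const 0ℤ) (suc k)) m ≡⟨ cong₂ _+_
      (total-scale c w (parts k m))
      (trans (shift-cong (suc k) (λ i → total-0 (parts (suc k) i)) m) (shift-0 (suc k) m)) ⟩
    c * gf w k m + 0ℤ                                          ≡⟨ ℤ.+-identityʳ _ ⟩
    c * gf w k m                                               ∎

-- The weights for `pod` and `qₑ₋ₒ`.

indicator : {P : Set} → Dec P → ℤ
indicator P? = if does P? then 1ℤ else 0ℤ

indicator-cong : {P Q : Set} → P ⇔ Q → (P? : Dec P) (Q? : Dec Q) → indicator P? ≡ indicator Q?
indicator-cong P⇔Q P? Q? = cong (if_then 1ℤ else 0ℤ) (does-⇔ P⇔Q P? Q?)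

indicator-false : {P : Set} → ¬ P → (P? : Dec P) → indicator P? ≡ 0ℤ
indicator-false ¬P P? = cong (if_then 1ℤ else 0ℤ) (dec-false P? ¬P)

length-filter-total : {P : List ℕ → Set} (P? : Decidable P) → ∀ xss →
  + length (filter P? xss) ≡ total (λ xs → indicator (P? xs)) xss
length-filter-total P? []         = refl
length-filter-total P? (xs ∷ xss) with P? xs
... | yes _ = cong (λ x → 1ℤ + x) (length-filter-total P? xss)
... | no _  = trans (length-filter-total P? xss) (sym (ℤ.+-identityˡ _))

length-total : ∀ (xss : List (List ℕ)) → + length xss ≡ total (const 1ℤ) xss
length-total []         = refl
length-total (xs ∷ xss) = cong (λ x → 1ℤ + x) (length-total xss)

2∣m+m : ∀ m → 2 ∣ m ℕ.+ m
2∣m+m m = divides m (trans (cong (m ℕ.+_) (sym (ℕ.+-identityʳ m))) (ℕ.*-comm 2 m))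

even⇒¬even-suc : ∀ {l} → 2 ∣ l → ¬ 2 ∣ suc l
even⇒¬even-suc {l} 2∣l 2∣1+l with ∣m+n∣m⇒∣n (subst (2 ∣_) (ℕ.+-comm 1 l) 2∣1+l) 2∣l
... | divides zero ()
... | divides (suc _) ()

¬even⇒even-suc : ∀ l → ¬ 2 ∣ l → 2 ∣ suc l
¬even⇒even-suc zero          ¬2∣0 = contradiction (2 ∣0) ¬2∣0
¬even⇒even-suc (suc zero)    _    = ∣-refl
¬even⇒even-suc (suc (suc l)) ¬2∣l = ∣m∣n⇒∣m+n (∣-refl {2}) (¬even⇒even-suc l (¬2∣l ∘ ∣m∣n⇒∣m+n (∣-refl {2})))

oddParts-even : ∀ {k} ys → 2 ∣ k → oddParts (k ∷ ys) ≡ oddParts ys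
oddParts-even ys 2∣k = filter-reject odd? (λ odd → odd 2∣k)

oddParts-odd : ∀ {k} ys → Odd k → oddParts (k ∷ ys) ≡ k ∷ oddParts ys
oddParts-odd ys odd = filter-accept odd? odd

unique-cons : ∀ {k ys} → All (_≤ k) ys → Unique (suc k ∷ ys) ⇔ Unique ys
unique-cons {k} ys≤k = mk⇔ (λ { (_ ∷ u) → u }) (All.map (λ { y≤k refl → ℕ.1+n≰n y≤k }) ys≤k ∷_)

¬unique-repeated : ∀ {k : ℕ} {ys} → ¬ Unique (k ∷ k ∷ ys)
¬unique-repeated ((k≢k ∷ _) ∷ _) = k≢k refl

podWeight : List ℕ → ℤ
podWeight xs = indicator (oddPartsDistinct? xs)

podWeight-even : ∀ {k} → 2 ∣ k → ∀ ys → podWeight (k ∷ ys) ≡ podWeight ys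
podWeight-even {k} 2∣k ys = indicator-cong
  (mk⇔ (subst Unique (oddParts-even ys 2∣k)) (subst Unique (sym (oddParts-even ys 2∣k))))
  (oddPartsDistinct? (k ∷ ys)) (oddPartsDistinct? ys)

podWeight-repeated : ∀ {k} → Odd k → ∀ ys → podWeight (k ∷ k ∷ ys) ≡ 0ℤ
podWeight-repeated {k} odd ys = indicator-false
  (¬unique-repeated ∘ subst Unique (trans (oddParts-odd (k ∷ ys) odd) (cong (k ∷_) (oddParts-odd ys odd))))
  (oddPartsDistinct? (k ∷ k ∷ ys))

podWeight-fresh : ∀ {k} → Odd (suc k) → ∀ ys → All (_≤ k) ys → podWeight (suc k ∷ ys) ≡ 1ℤ * podWeight ys
podWeight-fresh {k} odd ys ys≤k = trans
  (indicator-cong (mk⇔ (to ∘ subst Unique eq) (subst Unique (sym eq) ∘ from))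
    (oddPartsDistinct? (suc k ∷ ys)) (oddPartsDistinct? ys))
  (sym (ℤ.*-identityˡ _))
  where
  eq = oddParts-odd ys odd
  open Equivalence (unique-cons (All.filter⁺ odd? ys≤k))

-- On lists with distinct entries this is -1 to the power of the number of odd parts; on all others
-- it is 0.
signWeight : List ℕ → ℤ
signWeight xs = indicator (distinctEven? xs) + -1ℤ * indicator (distinctOdd? xs)

signWeight-repeated : ∀ k ys → signWeight (k ∷ k ∷ ys) ≡ 0ℤ
signWeight-repeated k ys = cong₂ (λ x y → x + -1ℤ * y)
  (indicator-false (¬unique-repeated ∘ proj₁) (distinctEven? (k ∷ k ∷ ys)))
  (indicator-false (¬unique-repeated ∘ proj₁) (distinctOdd? (k ∷ k ∷ ys)))

signWeight-even : ∀ {k} → 2 ∣ suc k → ∀ ys → All (_≤ k) ys → signWeight (suc k ∷ ys) ≡ 1ℤ * signWeight ys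
signWeight-even {k} 2∣k ys ys≤k = trans
  (cong₂ (λ x y → x + -1ℤ * y)
    (indicator-cong (parity (2 ∣_)) (distinctEven? (suc k ∷ ys)) (distinctEven? ys))
    (indicator-cong (parity Odd) (distinctOdd? (suc k ∷ ys)) (distinctOdd? ys)))
  (sym (ℤ.*-identityˡ _))
  where
  open Equivalence (unique-cons ys≤k)
  eq = cong length (oddParts-even ys 2∣k)

  parity : (P : ℕ → Set) → (Unique (suc k ∷ ys) × P (length (oddParts (suc k ∷ ys)))) ⇔
                           (Unique ys × P (length (oddParts ys)))
  parity P = mk⇔ (λ (u , q) → to u , subst P eq q) (λ (u , q) → from u , subst P (sym eq) q)

-- One more odd part flips the parity of their number, so the two indicators change places.
signWeight-odd : ∀ {k} → Odd (suc k) → ∀ ys → All (_≤ k) ys → signWeight (suc k ∷ ys) ≡ -1ℤ * signWeight ys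
signWeight-odd {k} odd ys ys≤k = trans
  (cong₂ (λ x y → x + -1ℤ * y)
    (indicator-cong even⇔odd (distinctEven? (suc k ∷ ys)) (distinctOdd? ys))
    (indicator-cong odd⇔even (distinctOdd? (suc k ∷ ys)) (distinctEven? ys)))
  (flip-sign (indicator (distinctOdd? ys)) (indicator (distinctEven? ys)))
  where
  open Equivalence (unique-cons ys≤k)
  eq = cong length (oddParts-odd ys odd)
  l = length (oddParts ys)

  flip-sign : ∀ x y → x + -1ℤ * y ≡ -1ℤ * (y + -1ℤ * x)
  flip-sign = solve-∀

  even⇔odd : DistinctEven (suc k ∷ ys) ⇔ DistinctOdd ys
  even⇔odd = mk⇔ (λ (u , e) → to u , λ e′ → even⇒¬even-suc e′ (subst (2 ∣_) eq e))
                 (λ (u , o) → from u , subst (2 ∣_) (sym eq) (¬even⇒even-suc l o))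

  -- `Odd` is a negation, so evenness has to be recovered by deciding it.
  even-if-not-odd : Odd (suc l) → 2 ∣ l
  even-if-not-odd o with 2 ∣? l
  ... | yes e = e
  ... | no ¬e = contradiction (¬even⇒even-suc l ¬e) o

  odd⇔even : DistinctOdd (suc k ∷ ys) ⇔ DistinctEven ys
  odd⇔even = mk⇔ (λ (u , o) → to u , even-if-not-odd (subst Odd eq o))
                 (λ (u , e) → from u , subst Odd (sym eq) (even⇒¬even-suc e))

pod-total : ∀ n → + pod n ≡ total podWeight (partitions n)
pod-total n = length-filter-total oddPartsDistinct? (partitions n)

qₑ₋ₒ-total : ∀ n → qₑ₋ₒ (+ n) ≡ total signWeight (partitions n)
qₑ₋ₒ-total n = begin
  qₑ₋ₒ (+ n)
    ≡⟨ ℤ.m-n≡m⊖n (count distinctEven? n) (count distinctOdd? n) ⟨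
  + count distinctEven? n - + count distinctOdd? n
    ≡⟨ cong (λ x → + count distinctEven? n + x) (sym (ℤ.-1*i≡-i (+ count distinctOdd? n))) ⟩
  + count distinctEven? n + -1ℤ * + count distinctOdd? n     ≡⟨ cong₂ (λ x y → x + -1ℤ * y)
    (length-filter-total distinctEven? (partitions n)) (length-filter-total distinctOdd? (partitions n)) ⟩
  total (λ xs → indicator (distinctEven? xs)) (partitions n) + -1ℤ * total (λ xs → indicator (distinctOdd? xs)) (partitions n)
    ≡⟨ total-linear -1ℤ (λ xs → indicator (distinctEven? xs)) (λ xs → indicator (distinctOdd? xs)) (partitions n) ⟨
  total signWeight (partitions n) ∎
  where open ≡-Reasoning

-- The value of `p` at `n / 2`.

halve : ∀ n → (∃[ m ] n ≡ m ℕ.+ m) ⊎ (∃[ m ] n ≡ suc (m ℕ.+ m))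
halve zero    = inj₁ (0 , refl)
halve (suc n) with halve n
... | inj₁ (m , refl) = inj₂ (m , refl)
... | inj₂ (m , refl) = inj₁ (suc m , cong suc (sym (ℕ.+-suc m m)))

pℚ-even : ∀ m → pℚ (+ (m ℕ.+ m) / 2) ≡ p m
-- Reduction to lowest terms does not compute for a variable `m`, so the fraction is compared with
-- `m / 1` by cross-multiplication. `mkℚᵘ` stores the denominator minus one.
pℚ-even m = cong pℚ (trans
  (ℚ.fromℚᵘ-cong {mkℚᵘ (+ (m ℕ.+ m)) 1} {mkℚᵘ (+ m) 0} (*≡* (double (+ m))))
  (ℚ.↥p/↧p≡p (mkℚ (+ m) 0 coprime)))
  where
  coprime : Coprime m 1
  coprime = coprime-sym (1-coprimeTo m)
  double : ∀ x → (x + x) * 1ℤ ≡ x * + 2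
  double = solve-∀

pℚ-odd : ∀ m → pℚ (+ suc (m ℕ.+ m) / 2) ≡ 0
pℚ-odd m with + suc (m ℕ.+ m) / 2 | ℚ.toℚᵘ-fromℚᵘ (mkℚᵘ (+ suc (m ℕ.+ m)) 1)
-- Only here could `pℚ` be nonzero, and `eq` would make `2m + 1` equal to `2a`. For every other
-- normal form `pℚ` is 0 by definition.
... | mkℚ (+ a)    zero    _ | *≡* eq = contradiction (divides a 2n≡) (even⇒¬even-suc (2∣m+m m))
  where
  2n≡ : suc (m ℕ.+ m) ≡ a ℕ.* 2
  2n≡ = ℤ.+-injective (trans (trans (sym (ℤ.*-identityʳ _)) (sym eq)) (sym (ℤ.pos-* a 2)))
... | mkℚ (+ a)    (suc _) _ | _ = refl
... | mkℚ -[1+ _ ] zero    _ | _ = refl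
... | mkℚ -[1+ _ ] (suc _) _ | _ = refl

pℚ-spread : ∀ n → + pℚ (+ n / 2) ≡ spread (λ m → + p m) n
pℚ-spread n with halve n
... | inj₁ (m , refl) = trans (cong +_ (pℚ-even m)) (sym (spread-double (λ m → + p m) m))
... | inj₂ (m , refl) = trans (cong +_ (pℚ-odd m)) (sym (spread-double+1 (λ m → + p m) m))

-- The infinite sum as a coefficient of a Cauchy product.

minus-suc : ∀ n j → + suc n - + suc j ≡ + n - + j
minus-suc n j = trans (ℤ.[1+m]⊖[1+n]≡m⊖n n j) (sym (ℤ.m-n≡m⊖n n j))

partialSum-cong : ∀ {f g} → f ≗ g → ∀ N → partialSum f N ≡ partialSum g N
partialSum-cong f≗g zero    = refl
partialSum-cong f≗g (suc N) = cong₂ _+_ (partialSum-cong f≗g N) (f≗g N)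

partialSum-suc : ∀ f N → partialSum f (suc N) ≡ f 0 + partialSum (f ∘ suc) N
partialSum-suc f zero    = ℤ.+-comm 0ℤ (f 0)
partialSum-suc f (suc N) =
  trans (cong (_+ f (suc N)) (partialSum-suc f N)) (ℤ.+-assoc (f 0) (partialSum (f ∘ suc) N) (f (suc N)))

module _ (g : ℤ → ℤ) where

  partialSum-⊛ : ∀ f n → partialSum (λ j → f j * g (+ n - + j)) (suc n) ≡ (f ⊛ (g ∘ +_)) n
  partialSum-⊛ f zero    = ℤ.+-identityˡ _
  partialSum-⊛ f (suc n) = begin
    partialSum (λ j → f j * g (+ suc n - + j)) (suc (suc n))
      ≡⟨ partialSum-suc (λ j → f j * g (+ suc n - + j)) (suc n) ⟩
    f 0 * g (+ suc n - + 0) + partialSum (λ j → f (suc j) * g (+ suc n - + suc j)) (suc n)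
      ≡⟨ cong₂ _+_ (cong (λ i → f 0 * g i) (ℤ.+-identityʳ (+ suc n)))
           (partialSum-cong (λ j → cong (λ i → f (suc j) * g i) (minus-suc n j)) (suc n)) ⟩
    f 0 * g (+ suc n) + partialSum (λ j → f (suc j) * g (+ n - + j)) (suc n)
      ≡⟨ cong (λ x → f 0 * g (+ suc n) + x) (partialSum-⊛ (f ∘ suc) n) ⟩
    (f ⊛ (g ∘ +_)) (suc n) ∎
    where open ≡-Reasoning

  -- For `j > n` the argument `n - j` is negative and the term vanishes, so the partial sums are
  -- constant from `n + 1` terms on.
  SumsTo-⊛ : (∀ m → g -[1+ m ] ≡ 0ℤ) → ∀ f n → (λ j → f j * g (+ n - + j)) SumsTo (f ⊛ (g ∘ +_)) n
  SumsTo-⊛ negative f n = suc n , λ N n<N → stable N (ℕ.m≤n⇒∃[o]m+o≡n n<N)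
    where
    term = λ j → f j * g (+ n - + j)

    beyond : ∀ n d → g (+ n - + suc (n ℕ.+ d)) ≡ 0ℤ
    beyond zero    d = negative d
    beyond (suc n) d = trans (cong g (minus-suc n (suc (n ℕ.+ d)))) (beyond n d)

    stable′ : ∀ d → partialSum term (suc n ℕ.+ d) ≡ (f ⊛ (g ∘ +_)) n
    stable′ zero    = trans (cong (partialSum term) (ℕ.+-identityʳ (suc n))) (partialSum-⊛ f n)
    stable′ (suc d) = begin
      partialSum term (suc n ℕ.+ suc d)           ≡⟨ cong (partialSum term) (ℕ.+-suc (suc n) d) ⟩
      partialSum term (suc n ℕ.+ d) + term (suc n ℕ.+ d) ≡⟨ cong₂ _+_ (stable′ d)
        (trans (cong (f (suc n ℕ.+ d) *_) (beyond n d)) (ℤ.*-zeroʳ (f (suc n ℕ.+ d)))) ⟩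
      (f ⊛ (g ∘ +_)) n + 0ℤ                       ≡⟨ ℤ.+-identityʳ _ ⟩
      (f ⊛ (g ∘ +_)) n                            ∎
      where open ≡-Reasoning

    stable : ∀ N → ∃[ d ] suc n ℕ.+ d ≡ N → partialSum term N ≡ (f ⊛ (g ∘ +_)) n
    stable N (d , refl) = stable′ d

-- Applying the product identity to the partition series.

pod⊛q : ∀ n → ((λ j → + pod j) ⊛ (qₑ₋ₒ ∘ +_)) n ≡ + pℚ (+ n / 2)
pod⊛q n = begin
  ((λ j → + pod j) ⊛ (qₑ₋ₒ ∘ +_)) n
    -- The bound on parts is `n + n`, which restricts nothing in degrees up to `n`.
    ≡⟨ ⊛-local n (λ i i<n → trans (pod-total i) (sym (gf-≥ podWeight (below i<n))))
                 (λ i i<n → trans (qₑ₋ₒ-total i) (sym (gf-≥ signWeight (below i<n)))) ⟩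
  (gf podWeight (n ℕ.+ n) ⊛ gf signWeight (n ℕ.+ n)) n
    ≡⟨ ⊛-≈-spread (gf podWeight) (gf signWeight) (gf (const 1ℤ))
         (gf-zero podWeight refl) (gf-zero signWeight refl) (gf-zero (const 1ℤ) refl)
         (λ m → gf-distinct podWeight (m ℕ.+ m) 1ℤ (podWeight-repeated (odd m)) (podWeight-fresh (odd m)))
         -- The preceding bound appears as `m + suc m`, but the recurrence asks for `suc (m + m)`;
         -- the same transport is needed for `signWeight` below.
         (λ m i → trans (gf-repeatable podWeight (m ℕ.+ suc m) (podWeight-even (2∣m+m (suc m))) i)
                       (cong (λ j → gf podWeight j i) (ℕ.+-suc m m)))
         (λ m → gf-distinct signWeight (m ℕ.+ m) -1ℤ (signWeight-repeated (suc (m ℕ.+ m))) (signWeight-odd (odd m)))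
         (λ m → subst (λ j → gf signWeight (suc m ℕ.+ suc m) ≗ factor 1ℤ (suc m ℕ.+ suc m) (gf signWeight j))
           (ℕ.+-suc m m)
           (gf-distinct signWeight (m ℕ.+ suc m) 1ℤ (signWeight-repeated (suc m ℕ.+ suc m))
             (signWeight-even (2∣m+m (suc m)))))
         (λ m → gf-repeatable (const 1ℤ) m (λ _ → refl))
         n n ℕ.≤-refl ⟩
  spread (gf (const 1ℤ) n) n
    ≡⟨ spread-local n (λ i i≤n → trans (gf-≥ (const 1ℤ) (ℕ.≤-pred i≤n)) (sym (length-total (partitions i)))) ⟩
  spread (λ m → + p m) n
    ≡⟨ pℚ-spread n ⟨
  + pℚ (+ n / 2) ∎
  where
  open ≡-Reasoning
  below : ∀ {i} → i < suc n → i ≤ n ℕ.+ n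
  below i≤n = ℕ.≤-trans (ℕ.≤-pred i≤n) (ℕ.m≤m+n n n)
  odd : ∀ m → Odd (suc (m ℕ.+ m))
  odd m = even⇒¬even-suc (2∣m+m m)

theorem4p9 : ∀ (n : ℕ) → (λ j → + pod j * qₑ₋ₒ (+ n - + j)) SumsTo (+ pℚ (+ n / 2))
theorem4p9 n = subst ((λ j → + pod j * qₑ₋ₒ (+ n - + j)) SumsTo_) (pod⊛q n)
  (SumsTo-⊛ qₑ₋ₒ (λ _ → refl) (λ j → + pod j) n)
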